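{- For any weak composition $a$ of length $n$, \[ \overline{\mathfrak{F}}_a^{(\beta)}=\sum_{\substack{b\ge a\\ b^+=a^+}}\overline{\mathfrak{P}}_b^{(\beta)}, \] where the sum is over weak compositions $b$ of length $n$, $\overline{\mathfrak{F}}_a^{(\beta)}$ is the glide polynomial of $a$ and $\overline{\mathfrak{P}}_b^{(\beta)}$ is the kaon of $b$.
   Context: Fix $n\ge1$; $\beta$ is a formal parameter. A weak composition of length $n$ is a sequence $a=(a_1,\dots,a_n)$ of nonnegative integers, and $\mathbf{x}^a=x_1^{a_1}\cdots x_n^{a_n}$. The positive part $a^+$ is the sequence obtained by deleting all zeros of $a$. $b\ge a$ means $b_1+\dots+b_i\ge a_1+\dots+a_i$ for all $1\le i\le n$. A weak komposition is a weak composition whose positive entries are each colored black or red (different colorings are different weak kompositions); its excess $\mathrm{ex}$ is the number of red entries. Let $a$ have nonzero entries exactly in positions $n_1<\dots<n_\ell$, and put $n_0=0$. A weak komposition $b$ of length $n$ is a glide of $a$ if there exist integers $0=i_0<i_1<\dots<i_\ell$ such that $b_k=0$ for $k>i_\ell$ and, for each $1\le j\le\ell$: $a_{n_j}=b_{i_{j-1}+1}+\dots+b_{i_j}-\mathrm{ex}(b_{i_{j-1}+1},\dots,b_{i_j})$; $i_j\le n_j$; and the leftmost nonzero entry among $b_{i_{j-1}+1},\dots,b_{i_j}$ is black. The glide polynomial is $\overline{\mathfrak{F}}_a^{(\beta)}=\sum_b\beta^{\mathrm{ex}(b)}\mathbf{x}^b$ over all glides $b$ of $a$. A weak komposition $b$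 of length $n$ is a mesonic glide of $a$ if $b_k=0$ for $k>n_\ell$ and, for each $1\le j\le\ell$: $a_{n_j}=b_{n_{j-1}+1}+\dots+b_{n_j}-\mathrm{ex}(b_{n_{j-1}+1},\dots,b_{n_j})$; the leftmost nonzero entry among $b_{n_{j-1}+1},\dots,b_{n_j}$ is black; and $b_{n_j}\ne0$. The kaon is $\overline{\mathfrak{P}}_a^{(\beta)}=\sum_b\beta^{\mathrm{ex}(b)}\mathbf{x}^b$ over all mesonic glides $b$ of $a$. -}

module Defs where

open import Data.Bool.Base using (if_then_else_)
open import Data.Fin.Base using (Fin; zero; suc; toℕ; inject₁; fromℕ)
open import Data.Fin.Properties using (all?)
open import Data.Integer.Base as ℤ using (ℤ; 0ℤ; 1ℤ)
open import Data.List.Base as List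
  using (List; []; _∷_; allFin; cartesianProductWith; concatMap; deduplicate;
         filter; foldr; length; upTo; _++_)
open import Data.List.Membership.Propositional using (_∈_; lose)
open import Data.List.Membership.Propositional.Properties
  using (∈-++⁺ˡ; ∈-++⁺ʳ; ∈-cartesianProductWith⁺; ∈-deduplicate⁺; ∈-filter⁺;
         ∈-filter⁻; ∈-map⁺; ∈-upTo⁺)
open import Data.List.Properties as List using ()
open import Data.List.Relation.Unary.Any as Any using (here; there)
open import Data.List.Relation.Unary.Unique.Propositional using (Unique)
open import Data.List.Relation.Unary.Unique.Propositional.Properties as Unique
  using ()
open import Data.List.Relation.Unary.Unique.DecPropositional.Properties
  using (deduplicate-!)
open import Data.Nat.Base
  using (ℕ; zero; suc; _+_; _∸_; _≤_; _<_; z≤n; s≤s)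
open import Data.Nat.Properties as ℕ
  using (_≟_; _≤?_; _<?_; ≤-trans; ≤-refl; ≤-reflexive; module ≤-Reasoning)
open import Data.Product.Base using (Σ-syntax; ∃; _×_; _,_; proj₁; proj₂)
open import Data.Vec.Base as Vec using (Vec; []; _∷_; lookup; toList)
open import Data.Vec.Properties as Vec using ()
open import Function.Base using (_∘_)
open import Relation.Binary.Definitions using (DecidableEquality)
open import Relation.Binary.PropositionalEquality
  using (_≡_; _≢_; refl; cong; subst)
open import Relation.Nullary.Decidable
  using (yes; no; does; ¬?; map′; _×-dec_; _→-dec_)
open import Relation.Nullary.Negation using (contradiction)
open import Relation.Unary using (Decidable)

record Finite {A : Set} (P : A → Set) : Set where
  field
    elements : List A
    unique   : Unique elements
    sound    : ∀ {x} → x ∈ elements → P x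
    complete : ∀ {x} → P x → x ∈ elements

open Finite public

finite : {A : Set} {P : A → Set} → DecidableEquality A → Decidable P →
         (xs : List A) → (∀ {x} → P x → x ∈ xs) → Finite P
finite _≈?_ P? xs bounds = record
  { elements = filter P? (deduplicate _≈?_ xs)
  ; unique   = Unique.filter⁺ P? (deduplicate-! _≈?_ xs)
  ; sound    = proj₂ ∘ ∈-filter⁻ P? {xs = deduplicate _≈?_ xs}
  ; complete = λ p → ∈-filter⁺ P? (∈-deduplicate⁺ _≈?_ (bounds p)) p
  }

vectors : {A : Set} → List A → ∀ m → List (Vec A m)
vectors xs zero    = [] ∷ []
vectors xs (suc m) = cartesianProductWith _∷_ xs (vectors xs m)

∈-vectors : {A : Set} {xs : List A} {m : ℕ} (v : Vec A m) →
            (∀ k → lookup v k ∈ xs) → v ∈ vectors xs m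
∈-vectors []      h = here refl
∈-vectors (x ∷ v) h = ∈-cartesianProductWith⁺ _∷_ (h zero) (∈-vectors v (h ∘ suc))

-- The term (c , e , a) stands for c · β ^ e · x₁ ^ a₁ ⋯ xₙ ^ aₙ, and a list of
-- terms stands for their sum, so that addition is concatenation.  The same
-- monomial may occur several times: equality is _≈_, not _≡_.
Polynomial : ℕ → Set
Polynomial n = List (ℤ × ℕ × Vec ℕ n)

coefficient : {n : ℕ} → Polynomial n → ℕ → Vec ℕ n → ℤ
coefficient p e a = foldr add 0ℤ p
  where
  add : ℤ × ℕ × Vec ℕ _ → ℤ → ℤ
  add (c , e′ , a′) s =
    if does ((e′ ≟ e) ×-dec Vec.≡-dec _≟_ a′ a) then c ℤ.+ s else s

infix 4 _≈_

_≈_ : {n : ℕ} → Polynomial n → Polynomial n → Set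
p ≈ q = ∀ e a → coefficient p e a ≡ coefficient q e a

β^_·x^_ : {n : ℕ} → ℕ → Vec ℕ n → Polynomial n
β^ e ·x^ a = (1ℤ , e , a) ∷ []

∑ : {A : Set} {P : A → Set} {n : ℕ} →
    Finite P → (A → Polynomial n) → Polynomial n
∑ F f = concatMap f (elements F)

WeakComposition : ℕ → Set
WeakComposition n = Vec ℕ n

nonzero? : Decidable (_≢ 0)
nonzero? k = ¬? (k ≟ 0)

infix 8 _⁺

_⁺ : {n : ℕ} → WeakComposition n → List ℕ
a ⁺ = filter nonzero? (toList a)

partialSum : {n : ℕ} → WeakComposition n → ℕ → ℕ
partialSum a i = List.sum (List.take i (toList a))

infix 4 _⊵_

_⊵_ : {n : ℕ} → WeakComposition n → WeakComposition n → Set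
_⊵_ {n} b a = (i : Fin n) → partialSum a (suc (toℕ i)) ≤ partialSum b (suc (toℕ i))

module _ {n : ℕ} (a : WeakComposition n) where

  support : List (Fin n)
  support = filter (λ k → nonzero? (lookup a k)) (allFin n)

  ℓ : ℕ
  ℓ = length support

  -- part j and positions (1 + j) are a_{n_{j+1}} and n_{j+1}, the index j being
  -- counted from 0 and the positions n_1 < … < n_ℓ from 1; the entry of index 0
  -- of positions is n₀ = 0.
  part : Fin ℓ → ℕ
  part j = lookup a (List.lookup support j)

  positions : Vec ℕ (suc ℓ)
  positions = 0 ∷ Vec.map (suc ∘ toℕ) (Vec.fromList support)

data Entry : Set where
  𝟎         : Entry
  black[1+_] : ℕ → Entry
  red[1+_]   : ℕ → Entry

value : Entry → ℕ
value 𝟎            = 0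
value black[1+ k ] = suc k
value red[1+ k ]   = suc k

redness : Entry → ℕ
redness 𝟎            = 0
redness black[1+ k ] = 0
redness red[1+ k ]   = 1

WeakKomposition : ℕ → Set
WeakKomposition n = Vec Entry n

total : List Entry → ℕ
total = List.sum ∘ List.map value

ex : List Entry → ℕ
ex = List.sum ∘ List.map redness

data LeftmostNonzeroBlack : List Entry → Set where
  here : ∀ {k es} → LeftmostNonzeroBlack (black[1+ k ] ∷ es)
  skip : ∀ {es} → LeftmostNonzeroBlack es → LeftmostNonzeroBlack (𝟎 ∷ es)

-- block b s t is (b_{s+1}, …, b_t), positions being counted from 1.
block : {n : ℕ} → WeakKomposition n → ℕ → ℕ → List Entry
block b s t = List.take (t ∸ s) (List.drop s (toList b))

-- The requirements shared by glides and mesonic glides: i₀, …, i_ℓ cut b into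
-- blocks matching the nonzero entries of a.
record Cuts {n : ℕ} (a : WeakComposition n) (b : WeakKomposition n)
            (i : Vec ℕ (suc (ℓ a))) : Set where
  blockAt : Fin (ℓ a) → List Entry
  blockAt j = block b (lookup i (inject₁ j)) (lookup i (suc j))

  field
    -- k counts from 0, so it stands for the position k + 1 > i_ℓ.
    vanishing : (k : Fin n) → lookup i (fromℕ (ℓ a)) ≤ toℕ k → lookup b k ≡ 𝟎
    -- a_{n_j} = total − ex, with ex moved to the left as ∸ truncates.
    sums      : (j : Fin (ℓ a)) → part a j + ex (blockAt j) ≡ total (blockAt j)
    leftmost  : (j : Fin (ℓ a)) → LeftmostNonzeroBlack (blockAt j)

record GlideAt {n : ℕ} (a : WeakComposition n) (b : WeakKomposition n)
               (i : Vec ℕ (suc (ℓ a))) : Set where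
  field
    start      : lookup i zero ≡ 0
    increasing : (j : Fin (ℓ a)) → lookup i (inject₁ j) < lookup i (suc j)
    cuts       : Cuts a b i
    bounded    : (j : Fin (ℓ a)) → lookup i (suc j) ≤ lookup (positions a) (suc j)

Glide : {n : ℕ} → WeakComposition n → WeakKomposition n → Set
Glide a b = Σ[ i ∈ Vec ℕ (suc (ℓ a)) ] GlideAt a b i

record MesonicGlide {n : ℕ} (a : WeakComposition n) (b : WeakKomposition n) :
                    Set where
  field
    cuts     : Cuts a b (positions a)
    occupied : (j : Fin (ℓ a)) → lookup b (List.lookup (support a) j) ≢ 𝟎

_≟ᴱ_ : DecidableEquality Entry
𝟎            ≟ᴱ 𝟎            = yes refl
𝟎            ≟ᴱ black[1+ l ] = no λ ()
𝟎            ≟ᴱ red[1+ l ]   = no λ ()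
black[1+ k ] ≟ᴱ 𝟎            = no λ ()
black[1+ k ] ≟ᴱ black[1+ l ] = map′ (cong black[1+_]) (λ { refl → refl }) (k ≟ l)
black[1+ k ] ≟ᴱ red[1+ l ]   = no λ ()
red[1+ k ]   ≟ᴱ 𝟎            = no λ ()
red[1+ k ]   ≟ᴱ black[1+ l ] = no λ ()
red[1+ k ]   ≟ᴱ red[1+ l ]   = map′ (cong red[1+_]) (λ { refl → refl }) (k ≟ l)

leftmostNonzeroBlack? : Decidable LeftmostNonzeroBlack
leftmostNonzeroBlack? []                  = no λ ()
leftmostNonzeroBlack? (𝟎 ∷ es)            =
  map′ skip (λ { (skip p) → p }) (leftmostNonzeroBlack? es)
leftmostNonzeroBlack? (black[1+ k ] ∷ es) = yes here
leftmostNonzeroBlack? (red[1+ k ] ∷ es)   = no λ ()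

module _ {n : ℕ} (a : WeakComposition n) where

  cuts? : (b : WeakKomposition n) → Decidable (Cuts a b)
  cuts? b i = map′
    (λ (v , s , l) → record { vanishing = v ; sums = s ; leftmost = l })
    (λ c → Cuts.vanishing c , Cuts.sums c , Cuts.leftmost c)
    (all? (λ k → (_ ≤? _) →-dec (_ ≟ᴱ _))
      ×-dec all? (λ j → _ ≟ _)
      ×-dec all? (λ j → leftmostNonzeroBlack? _))

  glideAt? : (b : WeakKomposition n) → Decidable (GlideAt a b)
  glideAt? b i = map′
    (λ (s , m , c , u) →
      record { start = s ; increasing = m ; cuts = c ; bounded = u })
    (λ g → let open GlideAt g in start , increasing , cuts , bounded)
    ((_ ≟ _)
      ×-dec all? (λ j → _ <? _)
      ×-dec cuts? b i
      ×-dec all? (λ j → _ ≤? _))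

  position≤n : ∀ j → lookup (positions a) j ≤ n
  position≤n zero    = z≤n
  position≤n (suc j) = go (support a) j
    where
    toℕ<n : ∀ {m} (k : Fin m) → suc (toℕ k) ≤ m
    toℕ<n zero    = s≤s z≤n
    toℕ<n (suc k) = s≤s (toℕ<n k)

    go : (ks : List (Fin n)) (j : Fin (length ks)) →
         lookup (Vec.map (suc ∘ toℕ) (Vec.fromList ks)) j ≤ n
    go (k ∷ ks) zero    = toℕ<n k
    go (k ∷ ks) (suc j) = go ks j

  glide? : Decidable (Glide a)
  glide? b = map′ Any.satisfied (λ (i , g) → lose (∈-vectors i (bound g)) g)
    (Any.any? (glideAt? b) (vectors (upTo (suc n)) (suc (ℓ a))))
    where
    bound : ∀ {i} → GlideAt a b i → ∀ j → lookup i j ∈ upTo (suc n)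
    bound g zero    = ∈-upTo⁺ (s≤s (≤-trans (≤-reflexive (GlideAt.start g)) z≤n))
    bound g (suc j) = ∈-upTo⁺ (s≤s (≤-trans (GlideAt.bounded g j) (position≤n (suc j))))

  mesonicGlide? : Decidable (MesonicGlide a)
  mesonicGlide? b = map′
    (λ (c , o) → record { cuts = c ; occupied = o })
    (λ m → MesonicGlide.cuts m , MesonicGlide.occupied m)
    (cuts? b (positions a) ×-dec all? (λ j → ¬? (_ ≟ᴱ _)))

  ⊵? : Decidable (_⊵ a)
  ⊵? b = all? (λ i → _ ≤? _)

entries : ℕ → List Entry
entries m = 𝟎 ∷ List.map black[1+_] (upTo m) ++ List.map red[1+_] (upTo m)

∈-entries : ∀ {m} e → value e ≤ m → e ∈ entries m
∈-entries 𝟎            p = here refl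
∈-entries black[1+ k ] p = there (∈-++⁺ˡ (∈-map⁺ black[1+_] (∈-upTo⁺ p)))
∈-entries red[1+ k ]   p = there (∈-++⁺ʳ _ (∈-map⁺ red[1+_] (∈-upTo⁺ p)))

redness≤value : ∀ e → redness e ≤ value e
redness≤value 𝟎            = z≤n
redness≤value black[1+ k ] = z≤n
redness≤value red[1+ k ]   = s≤s z≤n

redness≤1 : ∀ e → redness e ≤ 1
redness≤1 𝟎            = z≤n
redness≤1 black[1+ k ] = z≤n
redness≤1 red[1+ k ]   = ≤-refl

ex≤total : ∀ es → ex es ≤ total es
ex≤total []       = z≤n
ex≤total (e ∷ es) = ℕ.+-mono-≤ (redness≤value e) (ex≤total es)

value+ex≤1+total : ∀ {e es} → e ∈ es → value e + ex es ≤ suc (total es)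
value+ex≤1+total {e} {_ ∷ es} (here refl) = begin
  value e + (redness e + ex es) ≤⟨ ℕ.+-monoʳ-≤ (value e) (ℕ.+-mono-≤ (redness≤1 e) (ex≤total es)) ⟩
  value e + suc (total es)      ≡⟨ ℕ.+-suc (value e) (total es) ⟩
  suc (value e + total es)      ∎
  where open ≤-Reasoning
value+ex≤1+total {e} {e′ ∷ es} (there p) = begin
  value e + (redness e′ + ex es) ≡⟨ ℕ.+-assoc (value e) (redness e′) (ex es) ⟨
  value e + redness e′ + ex es   ≡⟨ cong (_+ ex es) (ℕ.+-comm (value e) (redness e′)) ⟩
  redness e′ + value e + ex es   ≡⟨ ℕ.+-assoc (redness e′) (value e) (ex es) ⟩
  redness e′ + (value e + ex es) ≤⟨ ℕ.+-mono-≤ (redness≤value e′) (value+ex≤1+total p) ⟩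
  value e′ + suc (total es)      ≡⟨ ℕ.+-suc (value e′) (total es) ⟩
  suc (value e′ + total es)      ∎
  where open ≤-Reasoning

∈-block : ∀ {n} (b : WeakKomposition n) k {s t} →
          s ≤ toℕ k → toℕ k < t → lookup b k ∈ block b s t
∈-block (e ∷ b) zero    {zero}  {suc t} p       q       = here refl
∈-block (e ∷ b) (suc k) {zero}  {suc t} p       (s≤s q) = there (∈-block b k z≤n q)
∈-block (e ∷ b) (suc k) {suc s} {suc t} (s≤s p) (s≤s q) = ∈-block b k p q

locate : ∀ {m} (i : Vec ℕ (suc m)) k → lookup i zero ≤ k → k < lookup i (fromℕ m) →
         ∃ λ (j : Fin m) → lookup i (inject₁ j) ≤ k × k < lookup i (suc j)
locate {zero}  (x ∷ [])    k p q = contradiction (≤-trans q p) (ℕ.<-irrefl refl)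
locate {suc m} (x ∷ y ∷ i) k p q with k <? y
... | yes k<y = zero , p , k<y
... | no  k≮y with locate (y ∷ i) k (ℕ.≮⇒≥ k≮y) q
...   | j , r = suc j , r

lookup≤sum : ∀ {n} (a : Vec ℕ n) k → lookup a k ≤ Vec.sum a
lookup≤sum (x ∷ a) zero    = ℕ.m≤m+n x _
lookup≤sum (x ∷ a) (suc k) = ≤-trans (lookup≤sum a k) (ℕ.m≤n+m _ x)

module _ {n : ℕ} (a : WeakComposition n) where

  candidates : List (WeakKomposition n)
  candidates = vectors (entries (suc (Vec.sum a))) n

  Cuts⇒∈candidates : ∀ {b i} → lookup i zero ≡ 0 → Cuts a b i → b ∈ candidates
  Cuts⇒∈candidates {b} {i} i₀≡0 c = ∈-vectors b (λ k → ∈-entries _ (bound k))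
    where
    open Cuts c

    bound : ∀ k → value (lookup b k) ≤ suc (Vec.sum a)
    bound k with lookup i (fromℕ (ℓ a)) ≤? toℕ k
    ... | yes p = ≤-trans (≤-reflexive (cong value (vanishing k p))) z≤n
    ... | no  p with locate i (toℕ k) (≤-trans (≤-reflexive i₀≡0) z≤n) (ℕ.≰⇒> p)
    ...   | j , q , r = ℕ.+-cancelʳ-≤ (ex (blockAt j)) _ _ (begin
      value (lookup b k) + ex (blockAt j)   ≤⟨ value+ex≤1+total (∈-block b k q r) ⟩
      suc (total (blockAt j))               ≡⟨ cong suc (sums j) ⟨
      suc (part a j + ex (blockAt j))       ≤⟨ s≤s (ℕ.+-monoˡ-≤ _ (lookup≤sum a (List.lookup (support a) j))) ⟩
      suc (Vec.sum a) + ex (blockAt j)      ∎)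
      where open ≤-Reasoning

  glides : Finite (Glide a)
  glides = finite (Vec.≡-dec _≟ᴱ_) (glide? a) candidates
    (λ (_ , g) → Cuts⇒∈candidates (GlideAt.start g) (GlideAt.cuts g))

  mesonicGlides : Finite (MesonicGlide a)
  mesonicGlides = finite (Vec.≡-dec _≟ᴱ_) (mesonicGlide? a) candidates
    (λ m → Cuts⇒∈candidates refl (MesonicGlide.cuts m))

  dominatingShifts : Finite (λ (b : WeakComposition n) → b ⊵ a × b ⁺ ≡ a ⁺)
  dominatingShifts = finite (Vec.≡-dec _≟_)
    (λ b → ⊵? a b ×-dec List.≡-dec _≟_ (b ⁺) (a ⁺))
    (vectors (0 ∷ toList a) n)
    (λ {b} (_ , b⁺≡a⁺) → ∈-vectors b (bound b b⁺≡a⁺))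
    where
    lookup∈toList : ∀ {m} (v : Vec ℕ m) k → lookup v k ∈ toList v
    lookup∈toList (x ∷ v) zero    = here refl
    lookup∈toList (x ∷ v) (suc k) = there (lookup∈toList v k)

    bound : (b : WeakComposition n) → b ⁺ ≡ a ⁺ → ∀ k → lookup b k ∈ 0 ∷ toList a
    bound b b⁺≡a⁺ k with lookup b k ≟ 0
    ... | yes p = here p
    ... | no  p = there (proj₁ (∈-filter⁻ nonzero?
      (subst (lookup b k ∈_) b⁺≡a⁺ (∈-filter⁺ nonzero? (lookup∈toList b k) p))))

monomial : {n : ℕ} → WeakKomposition n → Polynomial n
monomial b = β^ ex (toList b) ·x^ Vec.map value b

glidePolynomial : {n : ℕ} → WeakComposition n → Polynomial n
glidePolynomial a = ∑ (glides a) monomial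

kaon : {n : ℕ} → WeakComposition n → Polynomial n
kaon a = ∑ (mesonicGlides a) monomial

{-# OPTIONS --safe #-}

-- Once a block of a glide b has reached its sum, only zeros and red 1s may follow
-- in it, while the next block starts with a black entry: so the blocks of b are
-- determined up to trailing zeros.  Hence every glide b of a is a mesonic glide of
-- exactly one c with c⁺ = a⁺, the one placing each a_{n_j} at the last nonzero
-- entry of the j-th block.  When c⁺ = a⁺, the order c ⊵ a says that the nonzero
-- entries of c sit weakly to the left of those of a, which is i_j ≤ n_j.
module Submission where

open import Defs
open import Data.Bool.Base using (Bool; true; false; if_then_else_)
open import Data.Fin.Base using (Fin; zero; suc; toℕ; inject₁; fromℕ; fromℕ<)
open import Data.Fin.Properties using (toℕ-fromℕ; toℕ-fromℕ<)
open import Data.Integer.Base as ℤ using (ℤ; 1ℤ)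
open import Data.Integer.Properties as ℤ using ()
open import Data.List.Base as List
  using (List; []; _∷_; _++_; _∷ʳ_; allFin; concatMap; drop; filter; length; map;
         tabulate; take)
open import Data.List.Membership.Propositional using (_∈_; lose; find)
open import Data.List.Membership.Propositional.Properties
  using (∈-allFin; ∈-concatMap⁺; ∈-concatMap⁻; ∈-filter⁺; ∈-filter⁻; ∈-lookup)
open import Data.List.Membership.Propositional.Properties.WithK
  using (unique∧set⇒bag)
open import Data.List.Properties as List using ()
open import Data.List.Relation.Binary.BagAndSetEquality using (∼bag⇒↭)
open import Data.List.Relation.Binary.Disjoint.Propositional using (Disjoint)
open import Data.List.Relation.Binary.Permutation.Propositional as ↭
  using (_↭_)
open import Data.List.Relation.Binary.Permutation.Propositional.Properties as ↭
  using ()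
open import Data.List.Relation.Binary.Pointwise
  using (Pointwise; []; _∷_)
open import Data.List.Relation.Unary.All as All using (All; []; _∷_; all?)
open import Data.List.Relation.Unary.All.Properties as All using ()
open import Data.List.Relation.Unary.AllPairs
  using (AllPairs; []; _∷_)
open import Data.List.Relation.Unary.Any as Any using ()
open import Data.List.Relation.Unary.Any.Properties as Any using ()
open import Data.List.Relation.Unary.Unique.Propositional using (Unique)
open import Data.List.Relation.Unary.Unique.Propositional.Properties as Unique
  using ()
open import Data.Nat.Base
  using (ℕ; zero; suc; _+_; _∸_; _≤_; _<_; z≤n; s≤s; NonZero)
open import Data.Nat.ListAction using (sum)
open import Data.Nat.ListAction.Properties using (sum-++)
open import Data.Nat.Properties as ℕ using (≤-refl; ≤-trans; _≤?_; _≟_)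
open import Data.Product.Base using (∃-syntax; _×_; _,_; proj₁; proj₂)
open import Data.Vec.Base as Vec using (Vec; []; _∷_; lookup; toList)
open import Data.Vec.Properties as Vec using ()
open import Function.Base using (_∘_; id)
open import Function.Bundles using (mk⇔)
open import Relation.Binary.PropositionalEquality
  using (_≡_; _≢_; refl; sym; trans; cong; cong₂; subst; subst₂; module ≡-Reasoning)
open import Relation.Nullary.Decidable using (yes; no; does; _×-dec_)
open import Relation.Nullary.Negation using (¬_; contradiction)

-- Sums of monomials

-- A coefficient is a sum over the terms, and addition in `ℤ` is commutative. The two sides of the
-- theorem list the same monomials in different orders.
coefficient-↭ : ∀ {n} {p q : Polynomial n} → p ↭ q → p ≈ q
coefficient-↭ ↭.refl e a = refl
coefficient-↭ (↭.prep (c , e′ , a′) r) e a =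
  cong (λ s → if _ then c ℤ.+ s else s) (coefficient-↭ r e a)
coefficient-↭ {p = _ ∷ _ ∷ p} {_ ∷ _ ∷ q} (↭.swap (c , t) (d , u) r) e a =
  trans (cong (λ s → if hit t then c ℤ.+ add u d s else add u d s) (coefficient-↭ r e a))
        (exchange (hit t) (hit u) c d (coefficient q e a))
  where
  hit : ℕ × Vec ℕ _ → Bool
  hit (e′ , a′) = does ((e′ ≟ e) ×-dec Vec.≡-dec _≟_ a′ a)

  add : ℕ × Vec ℕ _ → ℤ → ℤ → ℤ
  add t c s = if hit t then c ℤ.+ s else s

  exchange : ∀ (u v : Bool) c d s →
    (if u then c ℤ.+ (if v then d ℤ.+ s else s) else (if v then d ℤ.+ s else s)) ≡
    (if v then d ℤ.+ (if u then c ℤ.+ s else s) else (if u then c ℤ.+ s else s))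
  exchange true  true  c d s = begin
    c ℤ.+ (d ℤ.+ s) ≡⟨ ℤ.+-assoc c d s ⟨
    c ℤ.+ d ℤ.+ s   ≡⟨ cong (ℤ._+ s) (ℤ.+-comm c d) ⟩
    d ℤ.+ c ℤ.+ s   ≡⟨ ℤ.+-assoc d c s ⟩
    d ℤ.+ (c ℤ.+ s) ∎
    where open ≡-Reasoning
  exchange true  false c d s = refl
  exchange false true  c d s = refl
  exchange false false c d s = refl
coefficient-↭ (↭.trans r r′) e a = trans (coefficient-↭ r e a) (coefficient-↭ r′ e a)

concatMap-monomial : ∀ {n} (bs : List (WeakKomposition n)) →
  concatMap monomial bs ≡ map (λ b → 1ℤ , ex (toList b) , Vec.map value b) bs
concatMap-monomial []       = refl
concatMap-monomial (b ∷ bs) = cong (_ ∷_) (concatMap-monomial bs)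

module _ {A B : Set} {P : A → Set} {Q : B → Set} {R : B → A → Set}
         (F : Finite P) (G : Finite Q) (H : ∀ c → Finite (R c))
         (fibre        : ∀ {b} → P b → ∃[ c ] Q c × R c b)
         (union        : ∀ {b c} → Q c → R c b → P b)
         (fibre-unique : ∀ {b c c′} → Q c → Q c′ → R c b → R c′ b → c ≡ c′)
         where

  private
    members : B → List A
    members c = elements (H c)

    disjoint₁ : ∀ {c cs} → Q c → All Q cs → All (c ≢_) cs →
                All (Disjoint (members c)) (map members cs)
    disjoint₁ q []        []           = []
    disjoint₁ q (q′ ∷ qs) (c≢c′ ∷ c≢) =
      (λ (x , y) → c≢c′ (fibre-unique q q′ (sound (H _) x) (sound (H _) y)))
      ∷ disjoint₁ q qs c≢

    disjoint : ∀ {cs} → All Q cs → Unique cs → AllPairs Disjoint (map members cs)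
    disjoint []       []       = []
    disjoint (q ∷ qs) (u ∷ us) = disjoint₁ q qs u ∷ disjoint qs us

  -- Both lists are free of repetitions and have the same members. On the right, freeness from
  -- repetitions holds because `fibre-unique` makes the fibres over distinct c disjoint.
  elements-↭ : elements F ↭ concatMap members (elements G)
  elements-↭ = ∼bag⇒↭ (unique∧set⇒bag (unique F)
    (Unique.concat⁺ (All.map⁺ (All.universal (λ c → unique (H c)) _))
                    (disjoint (All.tabulate (sound G)) (unique G)))
    (mk⇔ to from))
    where
    to : ∀ {b} → b ∈ elements F → b ∈ concatMap members (elements G)
    to b∈F = let c , q , r = fibre (sound F b∈F) in
      ∈-concatMap⁺ members (lose (complete G q) (complete (H c) r))

    from : ∀ {b} → b ∈ concatMap members (elements G) → b ∈ elements F
    from b∈ = let c , c∈G , b∈H = find (∈-concatMap⁻ members b∈) in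
      complete F (union (sound G c∈G) (sound (H c) b∈H))

-- Blocks

Blank : List Entry → Set
Blank = All (_≡ 𝟎)

Fits : ℕ → List Entry → Set
Fits p es = p + ex es ≡ total es × LeftmostNonzeroBlack es

ex-++ : ∀ us vs → ex (us ++ vs) ≡ ex us + ex vs
ex-++ us vs = trans (cong sum (List.map-++ redness us vs)) (sum-++ (map redness us) _)

total-++ : ∀ us vs → total (us ++ vs) ≡ total us + total vs
total-++ us vs = trans (cong sum (List.map-++ value us vs)) (sum-++ (map value us) _)

-- The leftmost nonzero entry adds at least 1 to `total` and nothing to `ex`; each later entry adds
-- at least as much to `total` as to `ex`.
leftmost⇒ex<total : ∀ {es} → LeftmostNonzeroBlack es → ex es < total es
leftmost⇒ex<total (here {es = es}) = s≤s (≤-trans (ex≤total es) (ℕ.m≤n+m _ _))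
leftmost⇒ex<total (skip l)         = leftmost⇒ex<total l

Fits⇒≢0 : ∀ {p es} → Fits p es → p ≢ 0
Fits⇒≢0 (s , l) refl = ℕ.<-irrefl s (leftmost⇒ex<total l)

leftmost⇒¬Blank : ∀ {es} → LeftmostNonzeroBlack es → ¬ Blank es
leftmost⇒¬Blank (skip l) (_ ∷ z) = leftmost⇒¬Blank l z

-- Lets a block absorb the trailing zeros of the block before it.
Fits-++ˡ : ∀ {p us vs} → Blank us → Fits p vs → Fits p (us ++ vs)
Fits-++ˡ []         f = f
Fits-++ˡ (refl ∷ z) f = let s , l = Fits-++ˡ z f in s , skip l

Blank⇒ex≡0 : ∀ {es} → Blank es → ex es ≡ 0
Blank⇒ex≡0 []         = refl
Blank⇒ex≡0 (refl ∷ z) = Blank⇒ex≡0 z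

Blank⇒total≡0 : ∀ {es} → Blank es → total es ≡ 0
Blank⇒total≡0 []         = refl
Blank⇒total≡0 (refl ∷ z) = Blank⇒total≡0 z

leftmost-++ʳ⁻ : ∀ us {vs} → Blank vs → LeftmostNonzeroBlack (us ++ vs) → LeftmostNonzeroBlack us
leftmost-++ʳ⁻ []       z l        = contradiction z (leftmost⇒¬Blank l)
leftmost-++ʳ⁻ (_ ∷ us) z here     = here
leftmost-++ʳ⁻ (_ ∷ us) z (skip l) = skip (leftmost-++ʳ⁻ us z l)

-- Lets a block be closed early, at its last nonzero entry.
Fits-++ʳ⁻ : ∀ {p} us {vs} → Blank vs → Fits p (us ++ vs) → Fits p us
Fits-++ʳ⁻ {p} us {vs} z (s , l) = s′ , leftmost-++ʳ⁻ us z l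
  where
  open ≡-Reasoning

  s′ : p + ex us ≡ total us
  s′ = begin
    p + ex us            ≡⟨ cong (p +_) (ℕ.+-identityʳ (ex us)) ⟨
    p + (ex us + 0)      ≡⟨ cong (λ k → p + (ex us + k)) (Blank⇒ex≡0 z) ⟨
    p + (ex us + ex vs)  ≡⟨ cong (p +_) (ex-++ us vs) ⟨
    p + ex (us ++ vs)    ≡⟨ s ⟩
    total (us ++ vs)     ≡⟨ total-++ us vs ⟩
    total us + total vs  ≡⟨ cong (total us +_) (Blank⇒total≡0 z) ⟩
    total us + 0         ≡⟨ ℕ.+-identityʳ (total us) ⟩
    total us             ∎

leftmost-not-red : ∀ {us k vs} → Blank us → ¬ LeftmostNonzeroBlack (us ++ red[1+ k ] ∷ vs)
leftmost-not-red (refl ∷ z) (skip l) = leftmost-not-red z l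

-- The difference of `total` and `ex` never decreases as entries are read; a black entry makes it
-- grow strictly.
+ex≤total-∷ʳ : ∀ p us e → p + ex us ≤ total us → p + ex (us ∷ʳ e) ≤ total (us ∷ʳ e)
+ex≤total-∷ʳ p us e h = begin
  p + ex (us ∷ʳ e)               ≡⟨ cong (p +_) (ex-++ us _) ⟩
  p + (ex us + (redness e + 0))  ≡⟨ ℕ.+-assoc p (ex us) _ ⟨
  p + ex us + (redness e + 0)    ≤⟨ ℕ.+-mono-≤ h (ℕ.+-monoˡ-≤ 0 (redness≤value e)) ⟩
  total us + (value e + 0)       ≡⟨ total-++ us _ ⟨
  total (us ∷ʳ e)                ∎
  where open ℕ.≤-Reasoning

+ex<total-∷ʳ-black : ∀ p us k → p + ex us ≤ total us →
                     p + ex (us ∷ʳ black[1+ k ]) < total (us ∷ʳ black[1+ k ])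
+ex<total-∷ʳ-black p us k h = begin-strict
  p + ex (us ∷ʳ black[1+ k ])  ≡⟨ cong (p +_) (trans (ex-++ us _) (ℕ.+-identityʳ _)) ⟩
  p + ex us                    ≤⟨ h ⟩
  total us                     <⟨ ℕ.m<m+n (total us) (s≤s z≤n) ⟩
  total us + (suc k + 0)       ≡⟨ total-++ us _ ⟨
  total (us ∷ʳ black[1+ k ])   ∎
  where open ℕ.≤-Reasoning

-- Mesonic glides, read from left to right: us is the part already read of the
-- current block, and a block closes exactly at the nonzero entries of c.
data Reads (us : List Entry) : ∀ {m} → Vec ℕ m → Vec Entry m → Set where
  end   : Blank us → Reads us [] []
  pass  : ∀ {m} {c : Vec ℕ m} {es e} → Reads (us ∷ʳ e) c es → Reads us (0 ∷ c) (e ∷ es)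
  close : ∀ {m} {c : Vec ℕ m} {es p e} → Fits (suc p) (us ∷ʳ e) → e ≢ 𝟎 →
          Reads [] c es → Reads us (suc p ∷ c) (e ∷ es)

-- Since `c ⁺` begins with p, the open block must close with sum exactly p; but its sum less its
-- excess is already above p and cannot decrease.
overfull : ∀ {m} {c : Vec ℕ m} {es us p ps} → p + ex us < total us →
           c ⁺ ≡ p ∷ ps → ¬ Reads us c es
overfull h () (end _)
overfull {us = us} {p} h refl (close {e = e} (s , _) _ _) =
  -- The strict inequality `h` unfolds to a weak one with `suc p` in place of p.
  ℕ.<-irrefl s (+ex≤total-∷ʳ (suc p) us e h)
overfull {us = us} {p} h c⁺ (pass {e = e} r) = overfull (+ex≤total-∷ʳ (suc p) us e h) c⁺ r

-- The open block can neither stay blank to the end nor close, its leftmost nonzero entry being red.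
¬Reads-red : ∀ {m} {c : Vec ℕ m} {es us k vs} → Blank us → ¬ Reads (us ++ red[1+ k ] ∷ vs) c es
¬Reads-red {us = us} z (end z′) with All.++⁻ʳ us z′
... | () ∷ _
¬Reads-red {us = us} z (close (_ , l) _ _) =
  leftmost-not-red z (subst LeftmostNonzeroBlack (List.++-assoc us _ _) l)
¬Reads-red {es = _ ∷ es} {us = us} z (pass {c = c} r) =
  ¬Reads-red z (subst (λ ws → Reads ws c es) (List.++-assoc us _ _) r)

-- One reading has completed a block of sum p in us; the other closed that block
-- and has read only zeros since.  The next nonzero entry decides: a black one
-- overfills the first block, a red one cannot open the second reading's next.
¬Reads-full : ∀ {m} {c c′ : Vec ℕ m} {es us vs p ps} → p + ex us ≤ total us → Blank vs →
              c ⁺ ≡ p ∷ ps → Reads us c es → ¬ Reads vs c′ es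
¬Reads-full h z () (end _) _
¬Reads-full {es = 𝟎 ∷ _} h z c⁺ (close _ e≢𝟎 _) _ = e≢𝟎 refl
¬Reads-full {es = 𝟎 ∷ _} h z c⁺ _ (close _ e≢𝟎 _) = e≢𝟎 refl
¬Reads-full {es = 𝟎 ∷ _} {us} {p = p} h z c⁺ (pass r) (pass r′) =
  ¬Reads-full (+ex≤total-∷ʳ p us 𝟎 h) (All.++⁺ z (refl ∷ [])) c⁺ r r′
¬Reads-full {es = black[1+ k ] ∷ _} {us} {p = p} h z refl (close (s , _) _ _) _ =
  ℕ.<-irrefl s (+ex<total-∷ʳ-black p us k h)
¬Reads-full {es = black[1+ k ] ∷ _} {us} {p = p} h z c⁺ (pass r) _ =
  overfull (+ex<total-∷ʳ-black p us k h) c⁺ r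
¬Reads-full {es = red[1+ _ ] ∷ _} h z c⁺ _ (close (_ , l) _ _) = leftmost-not-red z l
¬Reads-full {es = red[1+ _ ] ∷ _} h z c⁺ _ (pass r′) = ¬Reads-red z r′

-- Where c and c′ first differ in being zero, one reading closes a block and the other keeps it
-- open. Equal positive parts make the open block await the sum that it has just reached, which
-- `¬Reads-full` excludes.
Reads-unique : ∀ {m} {c c′ : Vec ℕ m} {es us} → c ⁺ ≡ c′ ⁺ →
               Reads us c es → Reads us c′ es → c ≡ c′
Reads-unique c⁺ (end _) (end _) = refl
Reads-unique c⁺ (pass r) (pass r′) = cong (0 ∷_) (Reads-unique c⁺ r r′)
Reads-unique c⁺ (pass r) (close (s , _) _ r′) =
  contradiction r′ (¬Reads-full (ℕ.≤-reflexive s) [] c⁺ r)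
Reads-unique c⁺ (close (s , _) _ r) (pass r′) =
  contradiction r (¬Reads-full (ℕ.≤-reflexive s) [] (sym c⁺) r′)
Reads-unique c⁺ (close _ _ r) (close _ _ r′) =
  let p≡p′ , c⁺′ = List.∷-injective c⁺ in cong₂ _∷_ p≡p′ (Reads-unique c⁺′ r r′)

-- Indexed by positions rather than by the support, so that the condition passes to tails.
Occupied : ∀ {m} → Vec ℕ m → Vec Entry m → Set
Occupied c es = ∀ k → lookup c k ≢ 0 → lookup es k ≢ 𝟎

Reads⇒Occupied : ∀ {m} {c : Vec ℕ m} {es us} → Reads us c es → Occupied c es
Reads⇒Occupied (pass r)        zero    0≢0 = contradiction refl 0≢0
Reads⇒Occupied (close _ e≢𝟎 _) zero    _   = e≢𝟎
Reads⇒Occupied (pass r)        (suc k)     = Reads⇒Occupied r k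
Reads⇒Occupied (close _ _ r)   (suc k)     = Reads⇒Occupied r k

-- Cuts into blocks

-- The list of the pairs (o + n_j , a_{n_j}).
marks : ∀ {m} → ℕ → Vec ℕ m → List (ℕ × ℕ)
marks o []          = []
marks o (zero  ∷ a) = marks (suc o) a
marks o (suc x ∷ a) = (suc o , suc x) ∷ marks (suc o) a

After : ℕ → ℕ × ℕ → Set
After s (t , _) = s < t

Sorted : List (ℕ × ℕ) → Set
Sorted = AllPairs λ (s , _) → After s

marks-after : ∀ {m} o (a : Vec ℕ m) → All (After o) (marks o a)
marks-after o []          = []
marks-after o (zero  ∷ a) = All.map ℕ.<⇒≤ (marks-after (suc o) a)
marks-after o (suc x ∷ a) = ≤-refl ∷ All.map ℕ.<⇒≤ (marks-after (suc o) a)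

marks-sorted : ∀ {m} o (a : Vec ℕ m) → Sorted (marks o a)
marks-sorted o []          = []
marks-sorted o (zero  ∷ a) = marks-sorted (suc o) a
marks-sorted o (suc x ∷ a) = marks-after (suc o) a ∷ marks-sorted (suc o) a

map-proj₂-marks : ∀ {m} o (a : Vec ℕ m) → map proj₂ (marks o a) ≡ a ⁺
map-proj₂-marks o []          = refl
map-proj₂-marks o (zero  ∷ a) = map-proj₂-marks (suc o) a
map-proj₂-marks o (suc x ∷ a) = cong (suc x ∷_) (map-proj₂-marks (suc o) a)

marks-support : ∀ {n} (a : Vec ℕ n) →
  map (λ k → suc (toℕ k) , lookup a k) (support a) ≡ marks 0 a
marks-support {n} a = go 0 a id (λ _ → refl) (λ _ → refl)
  where
  -- Peeling off an entry turns `tabulate f` into `tabulate (f ∘ suc)`, so the induction carries the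
  -- map f that sends the positions of the suffix a′ to those of a, a shift by o.
  go : ∀ {m} o (a′ : Vec ℕ m) (f : Fin m → Fin n) →
       (∀ k → lookup a (f k) ≡ lookup a′ k) → (∀ k → toℕ (f k) ≡ o + toℕ k) →
       map (λ k → suc (toℕ k) , lookup a k)
           (filter (λ k → nonzero? (lookup a k)) (tabulate f)) ≡ marks o a′
  go o []       f h h′ = refl
  go o (x ∷ a′) f h h′ with lookup a (f zero) in eq
    | go (suc o) a′ (f ∘ suc) (h ∘ suc) (λ k → trans (h′ (suc k)) (ℕ.+-suc o (toℕ k)))
  ... | zero  | ih rewrite sym (h zero) | eq = ih
  ... | suc y | ih rewrite sym (h zero) | eq =
    cong₂ _∷_ (cong₂ _,_ (cong suc (trans (h′ zero) (ℕ.+-identityʳ o))) refl) ih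

-- R s t m constrains a block (s , t] whose part sits at position m.
data Cutting (R : ℕ → ℕ → ℕ → Set) (es : List Entry) : ℕ → List (ℕ × ℕ) → Set where
  done : ∀ {s} → Blank (drop s es) → Cutting R es s []
  cut  : ∀ {s t m p ms} → R s t m → Fits p (take (t ∸ s) (drop s es)) →
         Cutting R es t ms → Cutting R es s ((m , p) ∷ ms)

-- The rules for the cut points: i_j = n_j for mesonic glides, i_{j-1} < i_j ≤ n_j for glides.
EndsAt EndsBy : ℕ → ℕ → ℕ → Set
EndsAt s t m = t ≡ m
EndsBy s t m = s < t × t ≤ m

vanishing⇒Blank : ∀ {n} s (b : WeakKomposition n) →
  (∀ k → s ≤ toℕ k → lookup b k ≡ 𝟎) → Blank (drop s (toList b))
vanishing⇒Blank zero    []      v = []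
vanishing⇒Blank zero    (e ∷ b) v = v zero z≤n ∷ vanishing⇒Blank zero b (λ k _ → v (suc k) z≤n)
vanishing⇒Blank (suc s) []      v = []
vanishing⇒Blank (suc s) (e ∷ b) v = vanishing⇒Blank s b (λ k h → v (suc k) (s≤s h))

Blank⇒vanishing : ∀ {n} s (b : WeakKomposition n) →
  Blank (drop s (toList b)) → ∀ k → s ≤ toℕ k → lookup b k ≡ 𝟎
Blank⇒vanishing zero    (e ∷ b) (z ∷ zs) zero    _       = z
Blank⇒vanishing zero    (e ∷ b) (z ∷ zs) (suc k) _       = Blank⇒vanishing zero b zs k z≤n
Blank⇒vanishing (suc s) (e ∷ b) zs       (suc k) (s≤s h) = Blank⇒vanishing s b zs k h

module _ (R : ℕ → ℕ → ℕ → Set) {n : ℕ} (a : WeakComposition n) (b : WeakKomposition n) where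

  -- Mediates between `Cuts`, indexed by the whole support, and the recursive `Cutting`: ks may be
  -- any list, so that induction can drop its head, and R covers both kinds of glides.
  record CutBy (ks : List (Fin n)) (i : Vec ℕ (suc (length ks))) : Set where
    field
      vanishing : ∀ k → lookup i (fromℕ (length ks)) ≤ toℕ k → lookup b k ≡ 𝟎
      steps     : ∀ j → R (lookup i (inject₁ j)) (lookup i (suc j)) (suc (toℕ (List.lookup ks j)))
      fits      : ∀ j → Fits (lookup a (List.lookup ks j))
                             (block b (lookup i (inject₁ j)) (lookup i (suc j)))

  private
    mark : Fin n → ℕ × ℕ
    mark k = suc (toℕ k) , lookup a k

  CutBy⇒Cutting : ∀ ks i → CutBy ks i → Cutting R (toList b) (lookup i zero) (map mark ks)
  CutBy⇒Cutting []       (s ∷ [])    h = done (vanishing⇒Blank s b (CutBy.vanishing h))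
  CutBy⇒Cutting (k ∷ ks) (s ∷ t ∷ i) h = cut (steps zero) (fits zero)
    (CutBy⇒Cutting ks (t ∷ i)
      record { vanishing = vanishing ; steps = steps ∘ suc ; fits = fits ∘ suc })
    where open CutBy h

  Cutting⇒CutBy : ∀ ks {s} → Cutting R (toList b) s (map mark ks) →
                  ∃[ i ] lookup i zero ≡ s × CutBy ks i
  Cutting⇒CutBy []       {s} (done z) = s ∷ [] , refl ,
    record { vanishing = Blank⇒vanishing s b z ; steps = λ () ; fits = λ () }
  Cutting⇒CutBy (k ∷ ks) {s} (cut r f c) with Cutting⇒CutBy ks c
  ... | t ∷ i , refl , h = s ∷ t ∷ i , refl , record
    { vanishing = CutBy.vanishing h
    ; steps     = λ { zero → r ; (suc j) → CutBy.steps h j }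
    ; fits      = λ { zero → f ; (suc j) → CutBy.fits h j }
    }

lookup-positions : ∀ {n} (ks : List (Fin n)) j →
  lookup (Vec.map {B = ℕ} (suc ∘ toℕ) (Vec.fromList ks)) j ≡ suc (toℕ (List.lookup ks j))
lookup-positions (k ∷ ks) zero    = refl
lookup-positions (k ∷ ks) (suc j) = lookup-positions ks j

module _ {n : ℕ} {a : WeakComposition n} {b : WeakKomposition n} where

  Glide⇒Cutting : Glide a b → Cutting EndsBy (toList b) 0 (marks 0 a)
  Glide⇒Cutting (i , g) = subst₂ (Cutting EndsBy (toList b)) start (marks-support a)
    (CutBy⇒Cutting EndsBy a b (support a) i record
      { vanishing = vanishing
      ; steps     = λ j → increasing j ,
                          ≤-trans (bounded j) (ℕ.≤-reflexive (lookup-positions (support a) j))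
      ; fits      = λ j → sums j , leftmost j
      })
    where
    open GlideAt g
    open Cuts cuts

  Cutting⇒Glide : Cutting EndsBy (toList b) 0 (marks 0 a) → Glide a b
  Cutting⇒Glide c with Cutting⇒CutBy EndsBy a b (support a)
                         (subst (Cutting EndsBy (toList b) 0) (sym (marks-support a)) c)
  ... | i , start , h = i , record
    { start      = start
    ; increasing = proj₁ ∘ steps
    ; cuts       = record { vanishing = vanishing ; sums = proj₁ ∘ fits ; leftmost = proj₂ ∘ fits }
    ; bounded    = λ j →
        ≤-trans (proj₂ (steps j)) (ℕ.≤-reflexive (sym (lookup-positions (support a) j)))
    }
    where open CutBy h

  MesonicGlide⇒Cutting : MesonicGlide a b → Cutting EndsAt (toList b) 0 (marks 0 a)
  MesonicGlide⇒Cutting g = subst (Cutting EndsAt (toList b) 0) (marks-support a)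
    (CutBy⇒Cutting EndsAt a b (support a) (positions a) record
      { vanishing = vanishing
      ; steps     = lookup-positions (support a)
      ; fits      = λ j → sums j , leftmost j
      })
    where
    open MesonicGlide g
    open Cuts cuts

  MesonicGlide⇒Occupied : MesonicGlide a b → Occupied a b
  MesonicGlide⇒Occupied g k aₖ≢0 = 
    subst (λ k → lookup b k ≢ 𝟎) (sym (Any.lookup-index k∈)) (occupied (Any.index k∈))
    where
    open MesonicGlide g
    k∈ = ∈-filter⁺ (λ k → nonzero? (lookup a k)) (∈-allFin k) aₖ≢0

  Cutting⇒MesonicGlide : Cutting EndsAt (toList b) 0 (marks 0 a) → Occupied a b → MesonicGlide a b
  Cutting⇒MesonicGlide c o with Cutting⇒CutBy EndsAt a b (support a)
                                  (subst (Cutting EndsAt (toList b) 0) (sym (marks-support a)) c)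
  ... | i , start , h = record
    { cuts     = subst (Cuts a b) i≡positions
        record { vanishing = vanishing ; sums = proj₁ ∘ fits ; leftmost = proj₂ ∘ fits }
    ; occupied = λ j →
        o _ (proj₂ (∈-filter⁻ (λ k → nonzero? (lookup a k)) {xs = allFin n} (∈-lookup j)))
    }
    where
    open CutBy h

    -- `EndsAt` leaves no freedom: each recovered cut point is the position of its part.
    agree : ∀ j → lookup i j ≡ lookup (positions a) j
    agree zero    = start
    agree (suc j) = trans (steps j) (sym (lookup-positions (support a) j))

    i≡positions : i ≡ positions a
    i≡positions = trans (sym (Vec.tabulate∘lookup i))
                  (trans (Vec.tabulate-cong agree) (Vec.tabulate∘lookup (positions a)))

-- Cuttings and readings

module _ {A : Set} {full us vs : List A} {s t : ℕ}
         (split : drop s full ≡ us ++ vs) (t≡ : t ≡ s + length us) where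

  take-segment : take (t ∸ s) (drop s full) ≡ us
  take-segment rewrite split | t≡ | ℕ.m+n∸m≡n s (length us) = go us
    where
    go : ∀ us → take (length us) (us ++ vs) ≡ us
    go []       = refl
    go (u ∷ us) = cong (u ∷_) (go us)

  drop-segment : drop t full ≡ vs
  drop-segment rewrite t≡ | sym (List.drop-drop s (length us) full) | split = go us
    where
    go : ∀ us → drop (length us) (us ++ vs) ≡ vs
    go []       = refl
    go (u ∷ us) = go us

module _ {full : List Entry} where

  private
    -- Preserves the invariant of both translations below: s is the last cut point, us what has been
    -- read since, es what is unread, and o the number of entries read in all. A block closing at e
    -- then ends at `suc o`, where `marks` records it.
    shift : ∀ {m} {s o us e} {es : Vec Entry m} →
      drop s full ≡ us ++ toList (e ∷ es) → o ≡ s + length us →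
      drop s full ≡ (us ∷ʳ e) ++ toList es × suc o ≡ s + length (us ∷ʳ e)
    shift {s = s} {us = us} h o≡ =
      trans h (sym (List.++-assoc us _ _)) ,
      trans (cong suc o≡) (trans (sym (ℕ.+-suc s (length us)))
        (cong (s +_) (sym (trans (List.length-++ us) (ℕ.+-comm (length us) 1)))))

  Reads⇒Cutting : ∀ {m} {c : Vec ℕ m} {es us s o} →
    drop s full ≡ us ++ toList es → o ≡ s + length us →
    Reads us c es → Cutting EndsAt full s (marks o c)
  Reads⇒Cutting {us = us} h o≡ (end z) = done (subst Blank (sym (trans h (List.++-identityʳ us))) z)
  Reads⇒Cutting h o≡ (pass r) = let h′ , o′≡ = shift h o≡ in Reads⇒Cutting h′ o′≡ r
  Reads⇒Cutting h o≡ (close f _ r) = let h′ , o′≡ = shift h o≡ in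
    cut refl (subst (Fits _) (sym (take-segment h′ o′≡)) f)
        (Reads⇒Cutting (drop-segment h′ o′≡) (sym (ℕ.+-identityʳ _)) r)

  Cutting⇒Reads : ∀ {m} {c : Vec ℕ m} {es us s o} →
    drop s full ≡ us ++ toList es → o ≡ s + length us →
    Cutting EndsAt full s (marks o c) → Occupied c es → Reads us c es
  Cutting⇒Reads {c = []} {[]} {us} h o≡ (done z) occ =
    end (subst Blank (trans h (List.++-identityʳ us)) z)
  Cutting⇒Reads {c = zero ∷ c} {e ∷ es} h o≡ k occ = let h′ , o′≡ = shift h o≡ in
    pass (Cutting⇒Reads h′ o′≡ k (occ ∘ suc))
  Cutting⇒Reads {c = suc p ∷ c} {e ∷ es} h o≡ (cut refl f k) occ = let h′ , o′≡ = shift h o≡ in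
    close (subst (Fits _) (take-segment h′ o′≡) f) (occ zero λ ())
          (Cutting⇒Reads (drop-segment h′ o′≡) (sym (ℕ.+-identityʳ _)) k (occ ∘ suc))

-- Dominance

infix 4 _≼_

_≼_ : ℕ × ℕ → ℕ × ℕ → Set
(t , p) ≼ (m , q) = t ≤ m × p ≡ q

-- The cut points stay and only their bounds move right. Sortedness of ms supplies the strict
-- increase that `EndsBy` asks for.
Cutting-≼ : ∀ {full s ms ns} → All (After s) ms → Sorted ms → Pointwise _≼_ ms ns →
            Cutting EndsAt full s ms → Cutting EndsBy full s ns
Cutting-≼ [] [] [] (done z) = done z
Cutting-≼ (s<t ∷ _) (as ∷ ss) ((t≤m , refl) ∷ ps) (cut refl f c) =
  cut (s<t , t≤m) f (Cutting-≼ as ss ps c)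

-- On `marks 0 a` this is the i-th partial sum of a, so dominance can be studied on marks alone.
weight : ℕ → List (ℕ × ℕ) → ℕ
weight i ms = sum (map proj₂ (filter (λ (t , _) → t ≤? i) ms))

weight-none : ∀ {i ms} → All (After i) ms → weight i ms ≡ 0
weight-none as = cong (sum ∘ map proj₂) (List.filter-none _ (All.map ℕ.<⇒≱ as))

weight-accept : ∀ {i t} p ms → t ≤ i → weight i ((t , p) ∷ ms) ≡ p + weight i ms
weight-accept {i} p ms h =
  cong (sum ∘ map proj₂) (List.filter-accept (λ (t , _) → t ≤? i) {x = _ , p} {ms} h)

weight-marks : ∀ {m} o (a : Vec ℕ m) i → weight (o + i) (marks o a) ≡ sum (take i (toList a))
weight-marks o a           zero    rewrite ℕ.+-identityʳ o = weight-none (marks-after o a)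
weight-marks o []          (suc i) = refl
weight-marks o (zero ∷ a)  (suc i) rewrite ℕ.+-suc o i = weight-marks (suc o) a i
weight-marks o (suc x ∷ a) (suc i) rewrite ℕ.+-suc o i =
  trans (weight-accept (suc x) (marks (suc o) a) (ℕ.m≤m+n (suc o) i))
        (cong (suc x +_) (weight-marks (suc o) a i))

weight-partialSum : ∀ {n} (a : WeakComposition n) i → weight i (marks 0 a) ≡ partialSum a i
weight-partialSum = weight-marks 0

weight-reject : ∀ {i t} p ms → i < t → weight i ((t , p) ∷ ms) ≡ weight i ms
weight-reject {i} p ms h =
  cong (sum ∘ map proj₂) (List.filter-reject (λ (t , _) → t ≤? i) {x = _ , p} {ms} (ℕ.<⇒≱ h))

weight-∷ : ∀ i t p ms → weight i ms ≤ weight i ((t , p) ∷ ms)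
weight-∷ i t p ms with t ≤? i
... | yes t≤i = ≤-trans (ℕ.m≤n+m _ p) (ℕ.≤-reflexive (sym (weight-accept p ms t≤i)))
... | no  t≰i = ℕ.≤-reflexive (sym (weight-reject p ms (ℕ.≰⇒> t≰i)))

-- A mark of ns counted at i has its partner in ms weakly to the left, hence counted too.
weight-≼ : ∀ {ms ns} → Pointwise _≼_ ms ns → ∀ i → weight i ns ≤ weight i ms
weight-≼ [] i = z≤n
weight-≼ {(t , p) ∷ ms} {(m , _) ∷ ns} ((t≤m , refl) ∷ ps) i with m ≤? i
... | yes m≤i = begin
  weight i ((m , p) ∷ ns)   ≡⟨ weight-accept p ns m≤i ⟩
  p + weight i ns           ≤⟨ ℕ.+-monoʳ-≤ p (weight-≼ ps i) ⟩
  p + weight i ms           ≡⟨ weight-accept p ms (≤-trans t≤m m≤i) ⟨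
  weight i ((t , p) ∷ ms)   ∎
  where open ℕ.≤-Reasoning
... | no m≰i = begin
  weight i ((m , p) ∷ ns)   ≡⟨ weight-reject p ns (ℕ.≰⇒> m≰i) ⟩
  weight i ns               ≤⟨ weight-≼ ps i ⟩
  weight i ms               ≤⟨ weight-∷ i t p ms ⟩
  weight i ((t , p) ∷ ms)   ∎
  where open ℕ.≤-Reasoning

-- If the first marks had m < t, then at i = m the weight of ms would vanish while that of ns is at
-- least q > 0. For the tails, q cancels when m ≤ i, and the tail of ns weighs nothing when i < m.
≼-weight : ∀ {ms ns} → Sorted ms → Sorted ns → All (λ (_ , p) → p ≢ 0) ns →
           map proj₂ ms ≡ map proj₂ ns → (∀ i → weight i ns ≤ weight i ms) → Pointwise _≼_ ms ns
≼-weight {[]}    {[]}    _ _ _ _ _ = []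
≼-weight {(t , p) ∷ ms} {(m , q) ∷ ns} (a ∷ as) (b ∷ bs) (q≢0 ∷ qs) eq h
  with refl , eqs ← List.∷-injective eq = (t≤m , refl) ∷ ≼-weight as bs qs eqs tail
  where
  t≤m : t ≤ m
  t≤m with t ≤? m
  ... | yes t≤m = t≤m
  ... | no  t≰m = contradiction (ℕ.m+n≡0⇒m≡0 q (ℕ.n≤0⇒n≡0 (begin
    q + weight m ns           ≡⟨ weight-accept q ns ≤-refl ⟨
    weight m ((m , q) ∷ ns)   ≤⟨ h m ⟩
    weight m ((t , q) ∷ ms)   ≡⟨ weight-none (m<t ∷ All.map (ℕ.<-trans m<t) a) ⟩
    0                         ∎))) q≢0
    where
    open ℕ.≤-Reasoning
    m<t = ℕ.≰⇒> t≰m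

  tail : ∀ i → weight i ns ≤ weight i ms
  tail i with m ≤? i
  ... | yes m≤i = ℕ.+-cancelˡ-≤ q _ _ (begin
    q + weight i ns           ≡⟨ weight-accept q ns m≤i ⟨
    weight i ((m , q) ∷ ns)   ≤⟨ h i ⟩
    weight i ((t , q) ∷ ms)   ≡⟨ weight-accept q ms (≤-trans t≤m m≤i) ⟩
    q + weight i ms           ∎)
    where open ℕ.≤-Reasoning
  ... | no  m≰i = ≤-trans (ℕ.≤-reflexive (weight-none (All.map (ℕ.<-trans (ℕ.≰⇒> m≰i)) b))) z≤n

marks-≢0 : ∀ {m} o (a : Vec ℕ m) → All (λ (_ , p) → p ≢ 0) (marks o a)
marks-≢0 o []          = []
marks-≢0 o (zero  ∷ a) = marks-≢0 (suc o) a
marks-≢0 o (suc x ∷ a) = (λ ()) ∷ marks-≢0 (suc o) a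

-- `_⊵_` speaks of 1 ≤ i ≤ n only; the sum at 0 is empty, and from n on the sums are constant.
⊵⇒partialSum-≤ : ∀ {n} {c a : WeakComposition n} → c ⊵ a → ∀ i → partialSum a i ≤ partialSum c i
⊵⇒partialSum-≤ {zero}  {[]} {[]} h i = ≤-refl
⊵⇒partialSum-≤ {suc n} h zero = z≤n
⊵⇒partialSum-≤ {suc n} {c} {a} h (suc i) with i ℕ.<? suc n
... | yes i<n =
  subst (λ i → partialSum a (suc i) ≤ partialSum c (suc i)) (toℕ-fromℕ< i<n) (h (fromℕ< i<n))
... | no  i≮n = subst₂ _≤_ (saturate a) (saturate c) (h (fromℕ n))
  where
  saturate : (v : WeakComposition (suc n)) → partialSum v (suc (toℕ (fromℕ n))) ≡
             partialSum v (suc i)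
  saturate v rewrite toℕ-fromℕ n =
    cong sum (trans (List.take-all (suc n) (toList v) (ℕ.≤-reflexive (Vec.length-toList v)))
               (sym (List.take-all (suc i) (toList v)
                 (≤-trans (ℕ.≤-reflexive (Vec.length-toList v))
                          (≤-trans (ℕ.≮⇒≥ i≮n) (ℕ.n≤1+n i))))))

module _ {n : ℕ} (c a : WeakComposition n) where

  ⊵⇒≼ : c ⊵ a → c ⁺ ≡ a ⁺ → Pointwise _≼_ (marks 0 c) (marks 0 a)
  ⊵⇒≼ c⊵a c⁺≡a⁺ = ≼-weight (marks-sorted 0 c) (marks-sorted 0 a) (marks-≢0 0 a)
    (trans (map-proj₂-marks 0 c) (trans c⁺≡a⁺ (sym (map-proj₂-marks 0 a))))
    (λ i → subst₂ _≤_ (sym (weight-partialSum a i)) (sym (weight-partialSum c i))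
                  (⊵⇒partialSum-≤ c⊵a i))

  ≼⇒⊵ : Pointwise _≼_ (marks 0 c) (marks 0 a) → c ⊵ a
  ≼⇒⊵ ps i = subst₂ _≤_ (weight-partialSum a _) (weight-partialSum c _) (weight-≼ ps (suc (toℕ i)))

  ≼⇒⁺≡ : Pointwise _≼_ (marks 0 c) (marks 0 a) → c ⁺ ≡ a ⁺
  ≼⇒⁺≡ ps = trans (sym (map-proj₂-marks 0 c)) (trans (values ps) (map-proj₂-marks 0 a))
    where
    values : ∀ {ms ns} → Pointwise _≼_ ms ns → map proj₂ ms ≡ map proj₂ ns
    values []              = refl
    values ((_ , e) ∷ ps)  = cong₂ _∷_ e (values ps)

-- From glides to mesonic glides

ReadBy : ∀ {m} → List Entry → Vec Entry m → ℕ → List (ℕ × ℕ) → Set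
ReadBy us es o ns = ∃[ c ] Reads us c es × Pointwise _≼_ (marks o c) ns

module _ {t : ℕ} {ns : List (ℕ × ℕ)} {rest : List Entry}
         (continue : ∀ {m us} → Blank us → (es : Vec Entry m) → toList es ≡ rest →
                     ReadBy us es t ns)
         where

  -- The zeros left after a block has closed early become the beginning of the next one; hence
  -- `continue` accepts any blank prefix.
  readBlank : ∀ {m} d {o us} (es : Vec Entry m) → Blank us → Blank (take d (toList es)) →
              drop d (toList es) ≡ rest → o + d ≡ t → ReadBy us es o ns
  readBlank zero {o} es z _ r o≡t with refl ← trans (sym (ℕ.+-identityʳ o)) o≡t = continue z es r
  readBlank (suc d) [] z _ r _ with [] , c ← continue z [] r = [] , c
  readBlank (suc d) {o} (_ ∷ es) z (refl ∷ z′) r o≡t =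
    let c , rs , ps = readBlank d es (All.++⁺ z (refl ∷ [])) z′ r (trans (sym (ℕ.+-suc o d)) o≡t)
    in  0 ∷ c , pass rs , ps

  -- Here us is the read part of the block and d the number of its entries still to come. That these
  -- are not all zero guarantees a last nonzero entry at which to place p.
  readBlock : ∀ {m} d {o n p} us (es : Vec Entry m) →
              Fits p (us ++ take d (toList es)) → ¬ Blank (take d (toList es)) →
              drop d (toList es) ≡ rest → o + d ≡ t → t ≤ n → ReadBy us es o ((n , p) ∷ ns)
  readBlock zero    us es       f ¬z r o≡t t≤n = contradiction [] ¬z
  readBlock (suc d) us []       f ¬z r o≡t t≤n = contradiction [] ¬z
  readBlock (suc d) {o} {p = p} us (e ∷ es) f ¬z r o≡t t≤n
    with f′ ← subst (Fits p) (sym (List.++-assoc us (e ∷ []) _)) f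
       | o+d ← trans (sym (ℕ.+-suc o d)) o≡t
       | all? (_≟ᴱ 𝟎) (take d (toList es))
  ... | no ¬z′ =
    let c , rs , ps = readBlock d (us ∷ʳ e) es f′ ¬z′ r o+d t≤n in 0 ∷ c , pass rs , ps
  -- Only zeros follow e, so e is the last nonzero entry. Its mark `suc o` satisfies suc o ≤ suc o +
  -- d = t ≤ n.
  ... | yes z  with f″ ← Fits-++ʳ⁻ (us ∷ʳ e) z f′ | p
  ...   | zero  = contradiction refl (Fits⇒≢0 f″)
  ...   | suc p =
    let c , rs , ps = readBlank d es [] z r o+d
    in  suc p ∷ c , close f″ (λ e≡𝟎 → ¬z (e≡𝟎 ∷ z)) rs ,
        (≤-trans (≤-trans (ℕ.m≤m+n (suc o) d) (ℕ.≤-reflexive o+d)) t≤n , refl) ∷ ps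

readZeros : ∀ {m us} o (es : Vec Entry m) → Blank us → Blank (toList es) → ReadBy us es o []
readZeros o []       z z′          = [] , end z , []
readZeros o (e ∷ es) z (refl ∷ z′) =
  let c , rs , ps = readZeros (suc o) es (All.++⁺ z (refl ∷ [])) z′ in 0 ∷ c , pass rs , ps

-- The recursive call is passed as the continuation `continue`, since the prefix with which the next
-- block starts is known only once the current block has been read.
Cutting⇒ReadBy : ∀ {full s ns m us} → Cutting EndsBy full s ns → Blank us →
                 (es : Vec Entry m) → toList es ≡ drop s full → ReadBy us es s ns
Cutting⇒ReadBy (done z′) z es eq = readZeros _ es z (subst Blank (sym eq) z′)
Cutting⇒ReadBy {full} {s} (cut {t = t} (s<t , t≤n) f c) z es eq =
  readBlock (Cutting⇒ReadBy c) (t ∸ s) _ es (Fits-++ˡ z f′) (leftmost⇒¬Blank (proj₂ f′))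
    (trans (cong (drop (t ∸ s)) eq)
           (trans (List.drop-drop s (t ∸ s) full) (cong (λ t → drop t full) s+d≡t)))
    s+d≡t t≤n
  where
  s+d≡t = ℕ.m+[n∸m]≡n (ℕ.<⇒≤ s<t)
  f′ = subst (λ xs → Fits _ (take (t ∸ s) xs)) (sym eq) f

-- Glides fibred over dominating compositions

module _ {n : ℕ} {b : WeakKomposition n} where

  MesonicGlide⇒Reads : ∀ {c} → MesonicGlide c b → Reads [] c b
  MesonicGlide⇒Reads g = Cutting⇒Reads refl refl (MesonicGlide⇒Cutting g) (MesonicGlide⇒Occupied g)

  Glide⇒MesonicGlide : ∀ {a} → Glide a b → ∃[ c ] (c ⊵ a × c ⁺ ≡ a ⁺) × MesonicGlide c b
  Glide⇒MesonicGlide {a} g =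
    let c , rs , ps = Cutting⇒ReadBy (Glide⇒Cutting g) [] b refl
    in  c , (≼⇒⊵ c a ps , ≼⇒⁺≡ c a ps)  ,
        Cutting⇒MesonicGlide (Reads⇒Cutting refl refl rs) (Reads⇒Occupied rs)

  MesonicGlide⇒Glide : ∀ {a c} → c ⊵ a × c ⁺ ≡ a ⁺ → MesonicGlide c b → Glide a b
  MesonicGlide⇒Glide {a} {c} (c⊵a , c⁺≡a⁺) g = Cutting⇒Glide
    (Cutting-≼ (marks-after 0 c) (marks-sorted 0 c) (⊵⇒≼ c a c⊵a c⁺≡a⁺) (MesonicGlide⇒Cutting g))

  MesonicGlide-unique : ∀ {c c′} → c ⁺ ≡ c′ ⁺ → MesonicGlide c b → MesonicGlide c′ b → c ≡ c′
  MesonicGlide-unique c⁺≡c′⁺ g g′ =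
    Reads-unique c⁺≡c′⁺ (MesonicGlide⇒Reads g) (MesonicGlide⇒Reads g′)

-- Summation over the fibres

proposition3p5 : (n : ℕ) .{{_ : NonZero n}} (a : WeakComposition n) →
    glidePolynomial a ≈ ∑ (dominatingShifts a) kaon
proposition3p5 n a e x = trans (coefficient-↭ glides↭ e x) (cong (λ p → coefficient p e x) regroup)
  where
  term : WeakKomposition n → ℤ × ℕ × Vec ℕ n
  term b = 1ℤ , ex (toList b) , Vec.map value b

  shifts : List (WeakComposition n)
  shifts = elements (dominatingShifts a)

  members : WeakComposition n → List (WeakKomposition n)
  members c = elements (mesonicGlides c)

  glides↭ : glidePolynomial a ↭ map term (concatMap members shifts)
  glides↭ = subst (_↭ map term (concatMap members shifts))
                  (sym (concatMap-monomial (elements (glides a))))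
    (↭.map⁺ term (elements-↭ (glides a) (dominatingShifts a) mesonicGlides
      Glide⇒MesonicGlide MesonicGlide⇒Glide
      -- Two compositions in the index set share the positive part of a, as uniqueness requires.
      (λ (_ , p) (_ , q) → MesonicGlide-unique (trans p (sym q)))))

  regroup : map term (concatMap members shifts) ≡ ∑ (dominatingShifts a) kaon
  regroup = trans (List.map-concatMap term members shifts)
                  (List.concatMap-cong (λ c → sym (concatMap-monomial (members c))) shifts)
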